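{- Let $0<c<a\le b<n$ be integers. There exists a latin square of order $n$ containing two subsquares, of orders $a$ and $b$ respectively, whose intersection is a subsquare of order $c$, if and only if \[ n-2b\ge a-2c\ge 0 \] and \[ (n-2a)(n-2b)\ge c^2-(n-2a-2b+3c)^2. \]
   Context: A latin square of order $n$ is an $n\times n$ matrix on $n$ symbols in which each symbol occurs exactly once in each row and each column. A subsquare of a latin square $L$ is a submatrix of $L$ (obtained by selecting some set of rows and some set of columns, not necessarily contiguous) that is itself a latin square; its order is its number of rows. The intersection of two subsquares is the set of cells lying in both. -}

module Defs where

open import Data.Nat using (ℕ)
open import Data.Fin using (Fin)
open import Data.Fin.Subset using (Subset; _∈_; ∣_∣; _∩_)
open import Data.Product using (Σ; _×_; _,_)
open import Relation.Binary.PropositionalEquality using (_≡_)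

Square : ℕ → Set
Square n = Fin n → Fin n → Fin n

ExactlyOneIn : ∀ {n} → Subset n → (Fin n → Set) → Set
ExactlyOneIn {n} X P =
  Σ (Fin n) (λ x → x ∈ X × P x) ×
  (∀ x y → x ∈ X → y ∈ X → P x → P y → x ≡ y)

record IsLatin {n : ℕ} (L : Square n) : Set where
  field
    row-once : ∀ (r s : Fin n) → Σ (Fin n) (λ c → L r c ≡ s) × (∀ c c' → L r c ≡ s → L r c' ≡ s → c ≡ c')
    col-once : ∀ (c s : Fin n) → Σ (Fin n) (λ r → L r c ≡ s) × (∀ r r' → L r c ≡ s → L r' c ≡ s → r ≡ r')

record IsSubsquare {n : ℕ} (L : Square n) (R C : Subset n) (k : ℕ) : Set where
  field
    symbols    : Subset n
    rows-size  : ∣ R ∣ ≡ k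
    cols-size  : ∣ C ∣ ≡ k
    syms-size  : ∣ symbols ∣ ≡ k
    entries-in : ∀ r c → r ∈ R → c ∈ C → L r c ∈ symbols
    row-once   : ∀ r s → r ∈ R → s ∈ symbols → ExactlyOneIn C (λ c → L r c ≡ s)
    col-once   : ∀ c s → c ∈ C → s ∈ symbols → ExactlyOneIn R (λ r → L r c ≡ s)

HasConfiguration : ℕ → ℕ → ℕ → ℕ → Set
HasConfiguration n a b c =
  Σ (Square n) λ L → IsLatin L ×
  Σ (Subset n) λ R₁ → Σ (Subset n) λ C₁ →
  Σ (Subset n) λ R₂ → Σ (Subset n) λ C₂ →
    IsSubsquare L R₁ C₁ a × IsSubsquare L R₂ C₂ b ×
    IsSubsquare L (R₁ ∩ R₂) (C₁ ∩ C₂) c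

{-# OPTIONS --safe #-}
module Submission where

-- Put p = a - c, q = b - c, d = n - a - b + c. Rows, columns and symbols fall into classes of sizes
-- c, p, q, d (in both subsquares, only the first, only the second, neither), and the number of cells
-- of each type (row class, column class, symbol class) is forced: counting along lines leaves no
-- choice. The conditions say exactly that these numbers are nonnegative: c ≤ p, q ≤ d and
-- d (c + p + q) ≤ d² + 2pq. Conversely, by Hilton's amalgamation theorem every nonnegative array with
-- the right line sums is the quotient of a latin square. To recover the latin square, split the
-- classes of rows, then of columns, then of symbols into singletons; each splitting writes a matrix
-- with row sums u vᵢ and column sums u wⱼ as a sum of u matrices with row sums vᵢ and column
-- sums wⱼ, and these are found by augmenting paths.

open import Defs

module LatinConfigurations where

  open import Data.Bool using (Bool; true; false; if_then_else_; not; _∧_; _∨_)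
  open import Data.Bool.Properties using () renaming (_≟_ to _≟ᵇ_)
  open import Data.Fin using (Fin; zero; suc; splitAt; _↑ˡ_; _↑ʳ_; _≟_)
  open import Data.Fin.Patterns
  open import Data.Fin.Permutation using (Permutation′; permutation)
  open import Data.Fin.Properties using (any?; splitAt-↑ˡ; splitAt-↑ʳ)
  open import Data.Fin.Subset using (Subset; _∈_; ∣_∣; _∩_)
  open import Data.Fin.Subset.Properties using (nonempty?; Empty-unique; ∣⊥∣≡0; x∈p∩q⁺; x∈p∩q⁻)
  open import Data.Nat using (ℕ; zero; suc; _+_; _*_; _∸_; _⊓_; _≤_; _<_; _≤?_; _<?_; z≤n; s≤s; >-nonZero)
    renaming (_≟_ to _≟ⁿ_)
  open import Data.Nat.Properties hiding (_≟_; _≤?_; _<?_)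
  open import Data.Nat.Tactic.RingSolver using (solve-∀)
  open import Data.Product using (Σ; ∃; _×_; _,_; proj₁; proj₂)
  open import Data.Sum using (_⊎_; inj₁; inj₂; [_,_]′)
  open import Data.Vec as Vec using (lookup; tabulate)
  open import Data.Vec.Properties using ([]=⇒lookup; lookup⇒[]=; lookup∘tabulate; lookup-zipWith)
  open import Data.Vec.Functional using (Vector; tail; []; _∷_)
  open import Function using (_∘_; const)
  open import Relation.Binary.PropositionalEquality hiding ([_])
  open import Relation.Nullary using (Dec; yes; no; does; contradiction; _×-dec_; _→-dec_)
  open import Relation.Nullary.Decidable using (dec-true; dec-false; map′; from-yes)
  open import Algebra.Properties.Semiring.Sum +-*-semiring

  private
    variable
      k l m n : ℕ

  -- Sums over Fin n

  sum-mono-≤ : {f g : Vector ℕ n} → (∀ i → f i ≤ g i) → sum f ≤ sum g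
  sum-mono-≤ {zero}  f≤g = z≤n
  sum-mono-≤ {suc n} f≤g = +-mono-≤ (f≤g zero) (sum-mono-≤ (f≤g ∘ suc))

  sum-mono-< : {f g : Vector ℕ n} → (∀ i → f i ≤ g i) → ∀ i → f i < g i → sum f < sum g
  sum-mono-< f≤g zero    lt = +-mono-<-≤ lt (sum-mono-≤ (f≤g ∘ suc))
  sum-mono-< f≤g (suc i) lt = +-mono-≤-< (f≤g zero) (sum-mono-< (f≤g ∘ suc) i lt)

  sum-≤-≡⇒≗ : {f g : Vector ℕ n} → (∀ i → f i ≤ g i) → sum f ≡ sum g → ∀ i → f i ≡ g i
  sum-≤-≡⇒≗ f≤g eq i with m≤n⇒m<n∨m≡n (f≤g i)
  ... | inj₁ lt = contradiction eq (<⇒≢ (sum-mono-< f≤g i lt))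
  ... | inj₂ e  = e

  term≤sum : (f : Vector ℕ n) → ∀ i → f i ≤ sum f
  term≤sum f zero    = m≤m+n _ _
  term≤sum f (suc i) = ≤-trans (term≤sum (f ∘ suc) i) (m≤n+m _ _)

  sum-zero : {f : Vector ℕ n} → (∀ i → f i ≡ 0) → sum f ≡ 0
  sum-zero {n} f≡0 = trans (sum-cong-≗ f≡0) (sum-replicate-zero n)

  sum-const : ∀ n a → sum {n} (λ _ → a) ≡ n * a
  sum-const zero    a = refl
  sum-const (suc n) a = cong (a +_) (sum-const n a)

  sum-split : ∀ m {n} (f : Vector ℕ (m + n)) → sum f ≡ sum (f ∘ (_↑ˡ n)) + sum (f ∘ (m ↑ʳ_))
  sum-split zero    f = refl
  sum-split (suc m) f = trans (cong (f zero +_) (sum-split m (f ∘ suc))) (sym (+-assoc (f zero) _ _))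

  -- Greedy filling: the head takes as much of `t` as it can hold and the tail supplies the rest.
  -- This gives the starting rows of the splitting, before any column sum is repaired.
  subvector : (f : Vector ℕ n) → ∀ {t} → t ≤ sum f →
              Σ (Vector ℕ n) λ g → (∀ i → g i ≤ f i) × sum g ≡ t
  subvector {zero}  f {t} z≤n = f , (λ ()) , refl
  subvector {suc n} f {t} t≤ with subvector (tail f) (m≤n+o⇒m∸n≤o _ (f zero) t≤)
  ... | g , g≤f , sum-g =
    (λ { zero → f zero ⊓ t ; (suc i) → g i }) ,
    (λ { zero → m⊓n≤m _ t ; (suc i) → g≤f i }) ,
    trans (cong (f zero ⊓ t +_) sum-g) (m⊓n+n∸m≡n (f zero) t)

  χ : Bool → ℕ
  χ b = if b then 1 else 0

  δ : Fin n → Fin n → ℕ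
  δ i j = χ (does (i ≟ j))

  δ-≢ : {i j : Fin n} → i ≢ j → δ i j ≡ 0
  δ-≢ {i = i} {j} i≢j = cong χ (dec-false (i ≟ j) i≢j)

  sum-δ : (i : Fin n) → sum (δ i) ≡ 1
  sum-δ {suc n} zero = cong suc (sum-zero {n} {λ _ → 0} λ _ → refl)
  sum-δ (suc i) = trans (cong₂ _+_ (δ-≢ {i = suc i} {zero} λ ()) (sum-cong-≗ δ-suc)) (sum-δ i)
    where
    δ-suc : ∀ j → δ (suc i) (suc j) ≡ δ i j
    δ-suc j with i ≟ j
    ... | yes refl = refl
    ... | no _     = refl

  -- Matrices and their line sums

  Matrix : ℕ → ℕ → Set
  Matrix k l = Fin k → Fin l → ℕ

  rowSum : Matrix k l → Vector ℕ k
  rowSum M i = sum (M i)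

  colSum : Matrix k l → Vector ℕ l
  colSum M j = sum (λ i → M i j)

  infix 4 _≤ᴹ_
  _≤ᴹ_ : Matrix k l → Matrix k l → Set
  Y ≤ᴹ M = ∀ i j → Y i j ≤ M i j

  unit : Fin k → Fin l → Matrix k l
  unit i j i′ j′ = δ i i′ * δ j j′

  rowSum-unit : (i : Fin k) (j : Fin l) → rowSum (unit i j) ≗ δ i
  rowSum-unit i j i′ = trans (sym (*-distribˡ-sum (δ i i′) (δ j)))
    (trans (cong (δ i i′ *_) (sum-δ j)) (*-identityʳ _))

  colSum-unit : (i : Fin k) (j : Fin l) → colSum (unit i j) ≗ δ j
  colSum-unit i j j′ = trans (sym (*-distribʳ-sum (δ j j′) (δ i)))
    (trans (cong (_* δ j j′) (sum-δ i)) (*-identityˡ _))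

  +unit-≤ : {Y M : Matrix k l} → Y ≤ᴹ M → ∀ {i j} → Y i j < M i j →
            ∀ i′ j′ → Y i′ j′ + unit i j i′ j′ ≤ M i′ j′
  +unit-≤ Y≤M {i} {j} lt i′ j′ with i ≟ i′ | j ≟ j′
  ... | yes refl | yes refl = ≤-trans (≤-reflexive (+-comm _ 1)) lt
  ... | yes _    | no _     = ≤-trans (≤-reflexive (+-identityʳ _)) (Y≤M i′ j′)
  ... | no _     | _        = ≤-trans (≤-reflexive (+-identityʳ _)) (Y≤M i′ j′)

  -- Splitting a matrix

  module Splitting {k l} (M : Matrix k l) (v : Vector ℕ k) (w : Vector ℕ l) (u : ℕ)
    (rows : ∀ i → rowSum M i ≡ suc u * v i) (cols : ∀ j → colSum M j ≡ suc u * w j) where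

    -- Row sums are exact from the start and stay exact. Only column sums may be wrong, so what
    -- remains is to remove their excess over `w`.
    record Partial (Y : Matrix k l) : Set where
      field
        bounded : Y ≤ᴹ M
        rows-ok : ∀ i → rowSum Y i ≡ v i

    open Partial

    module Augment (Y : Matrix k l) (Y-ok : Partial Y) (j₀ : Fin l) (excess : w j₀ < colSum Y j₀) where

      -- Y′ arises from Y by pushing one unit from column j₀ to column j along an alternating
      -- path inside the columns of J.
      record Shift (J : Fin l → Bool) (j : Fin l) : Set where
        field
          Y′      : Matrix k l
          partial : Partial Y′
          shifted : ∀ j′ → colSum Y′ j′ + δ j₀ j′ ≡ colSum Y j′ + δ j j′
          outside : ∀ i j′ → J j′ ≡ false → Y′ i j′ ≡ Y i j′
          grows   : ∀ i → Y i j ≤ Y′ i j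

      open Shift

      insert : Fin l → (Fin l → Bool) → Fin l → Bool
      insert j J j′ = does (j ≟ j′) ∨ J j′

      insert-false : ∀ j J j′ → insert j J j′ ≡ false → j ≢ j′ × J j′ ≡ false
      insert-false j J j′ eq with j ≟ j′
      ... | no j≢j′ = j≢j′ , eq

      insert-true : ∀ j J j′ → insert j J j′ ≡ true → j ≡ j′ ⊎ J j′ ≡ true
      insert-true j J j′ eq with j ≟ j′
      ... | yes e = inj₁ e
      ... | no _  = inj₂ eq

      true≢false : ∀ {J : Fin l → Bool} {j j′} → J j ≡ true → J j′ ≡ false → j ≢ j′
      true≢false p q refl with trans (sym p) q
      ... | ()

      trivial : ∀ (J : Fin l → Bool) → Shift J j₀
      trivial J = record
        { Y′ = Y ; partial = Y-ok ; shifted = λ _ → refl ; outside = λ _ _ _ → refl ; grows = λ _ → ≤-refl }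

      weaken : ∀ {J j} j₂ → Shift J j → Shift (insert j₂ J) j
      weaken {J} j₂ S = record
        { Y′ = Y′ S ; partial = partial S ; shifted = shifted S
        ; outside = λ i j′ eq → outside S i j′ (proj₂ (insert-false j₂ J j′ eq)) ; grows = grows S }

      -- The path is prolonged by moving one unit of row `i` from column `j₁` to the new column
      -- `j₂`. Both tests are made on `Y`, not on the already modified matrix: `grows` keeps the
      -- entry in column `j₁` positive, and `outside` keeps the room in column `j₂`.
      extend : ∀ {J i j₁ j₂} → J j₁ ≡ true → J j₂ ≡ false → 0 < Y i j₁ → Y i j₂ < M i j₂ →
               Shift J j₁ → Shift (insert j₂ J) j₂
      extend {J} {i} {j₁} {j₂} Jj₁ Jj₂ pos lt S = record
        { Y′ = Y″
        ; partial = record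
          { bounded = λ i′ j′ → ≤-trans (m∸n≤m _ (unit i j₁ i′ j′)) (Z+unit≤M i′ j′)
          ; rows-ok = λ i′ → trans (rows-same i′) (rows-ok (partial S) i′)
          }
        ; shifted = λ j′ → +-cancelʳ-≡ (colSum Z j′ + δ j₁ j′) _ _ (begin
            colSum Y″ j′ + δ j₀ j′ + (colSum Z j′ + δ j₁ j′)  ≡⟨ swap (colSum Y″ j′) (δ j₀ j′) (colSum Z j′) (δ j₁ j′) ⟩
            (colSum Y″ j′ + δ j₁ j′) + (colSum Z j′ + δ j₀ j′) ≡⟨ cong₂ _+_ (cols-shift j′) (shifted S j′) ⟩
            (colSum Z j′ + δ j₂ j′) + (colSum Y j′ + δ j₁ j′)  ≡⟨ swap′ (colSum Z j′) (δ j₂ j′) (colSum Y j′) (δ j₁ j′) ⟩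
            colSum Y j′ + δ j₂ j′ + (colSum Z j′ + δ j₁ j′)   ∎)
        ; outside = λ i′ j′ eq → let (j₂≢j′ , Jj′) = insert-false j₂ J j′ eq in
            trans (cong₂ (λ a b → Z i′ j′ + δ i i′ * a ∸ δ i i′ * b) (δ-≢ j₂≢j′) (δ-≢ (true≢false {J} Jj₁ Jj′)))
            (trans (cong (λ a → Z i′ j′ + a ∸ a) (*-zeroʳ (δ i i′))) (trans (+-identityʳ _) (outside S i′ j′ Jj′)))
        ; grows = λ i′ → ≤-trans (≤-reflexive (sym (outside S i′ j₂ Jj₂)))
            (≤-trans (m≤m+n (Z i′ j₂) (unit i j₂ i′ j₂)) (≤-reflexive (sym
              (cong (Z i′ j₂ + unit i j₂ i′ j₂ ∸_)
                (trans (cong (δ i i′ *_) (δ-≢ (true≢false {J} Jj₁ Jj₂))) (*-zeroʳ (δ i i′)))))))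
        }
        where
        open ≡-Reasoning
        Z = Y′ S
        -- The truncated subtraction is exact, since `Z` has a unit to give away in row `i`, column
        -- `j₁`; `balance` records this, and all line sums are computed from it additively.
        Y″ : Matrix k l
        Y″ i′ j′ = Z i′ j′ + unit i j₂ i′ j′ ∸ unit i j₁ i′ j′
        unit≤Z : unit i j₁ ≤ᴹ Z
        unit≤Z = +unit-≤ {Y = λ _ _ → 0} (λ _ _ → z≤n) (≤-trans pos (grows S i))
        Z+unit≤M : ∀ i′ j′ → Z i′ j′ + unit i j₂ i′ j′ ≤ M i′ j′
        Z+unit≤M = +unit-≤ (bounded (partial S)) (≤-trans (≤-reflexive (cong suc (outside S i j₂ Jj₂))) lt)
        balance : ∀ i′ j′ → Y″ i′ j′ + unit i j₁ i′ j′ ≡ Z i′ j′ + unit i j₂ i′ j′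
        balance i′ j′ = m∸n+n≡m (≤-trans (unit≤Z i′ j′) (m≤m+n _ _))
        rows-same : ∀ i′ → rowSum Y″ i′ ≡ rowSum Z i′
        rows-same i′ = +-cancelʳ-≡ (δ i i′) _ _ (begin
          rowSum Y″ i′ + δ i i′                      ≡⟨ cong (rowSum Y″ i′ +_) (rowSum-unit i j₁ i′) ⟨
          rowSum Y″ i′ + rowSum (unit i j₁) i′       ≡⟨ ∑-distrib-+ (Y″ i′) _ ⟨
          sum (λ j → Y″ i′ j + unit i j₁ i′ j)       ≡⟨ sum-cong-≗ (balance i′) ⟩
          sum (λ j → Z i′ j + unit i j₂ i′ j)        ≡⟨ ∑-distrib-+ (Z i′) _ ⟩
          rowSum Z i′ + rowSum (unit i j₂) i′        ≡⟨ cong (rowSum Z i′ +_) (rowSum-unit i j₂ i′) ⟩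
          rowSum Z i′ + δ i i′                       ∎)
        cols-shift : ∀ j′ → colSum Y″ j′ + δ j₁ j′ ≡ colSum Z j′ + δ j₂ j′
        cols-shift j′ = begin
          colSum Y″ j′ + δ j₁ j′                     ≡⟨ cong (colSum Y″ j′ +_) (colSum-unit i j₁ j′) ⟨
          colSum Y″ j′ + colSum (unit i j₁) j′       ≡⟨ ∑-distrib-+ (λ i′ → Y″ i′ j′) _ ⟨
          sum (λ i′ → Y″ i′ j′ + unit i j₁ i′ j′)    ≡⟨ sum-cong-≗ (λ i′ → balance i′ j′) ⟩
          sum (λ i′ → Z i′ j′ + unit i j₂ i′ j′)     ≡⟨ ∑-distrib-+ (λ i′ → Z i′ j′) _ ⟩
          colSum Z j′ + colSum (unit i j₂) j′        ≡⟨ cong (colSum Z j′ +_) (colSum-unit i j₂ j′) ⟩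
          colSum Z j′ + δ j₂ j′                      ∎
        swap : ∀ a b c d → a + b + (c + d) ≡ (a + d) + (c + b)
        swap = solve-∀
        swap′ : ∀ a b c d → (a + b) + (c + d) ≡ c + b + (a + d)
        swap′ = solve-∀

      -- In each row, Y uses at most the fraction 1/(u+1) of the weight of M on a closed J.
      closed-absurd : ∀ (J : Fin l → Bool) → J j₀ ≡ true → (∀ j → J j ≡ true → w j ≤ colSum Y j) →
        (∀ i j₁ j₂ → J j₁ ≡ true → J j₂ ≡ false → 0 < Y i j₁ → M i j₂ ≤ Y i j₂) → ∀ {A : Set} → A
      closed-absurd J Jj₀ no-def closed = contradiction strict (≤⇒≯ total)
        where
        inn out : (Fin l → ℕ) → ℕ
        inn f = sum (λ j → χ (J j) * f j)
        out f = sum (λ j → χ (not (J j)) * f j)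
        split : ∀ f → inn f + out f ≡ sum f
        split f = trans (sym (∑-distrib-+ (λ j → χ (J j) * f j) _)) (sum-cong-≗ λ j → lem (J j) (f j))
          where
          lem : ∀ b x → χ b * x + χ (not b) * x ≡ x
          lem true  x = trans (+-identityʳ _) (+-identityʳ x)
          lem false x = +-identityʳ x
        row-bound : ∀ i → suc u * inn (Y i) ≤ inn (M i)
        row-bound i with any? (λ j → (J j ≟ᵇ true) ×-dec (0 <? Y i j))
        ... | no none = ≤-trans (≤-reflexive (trans (cong (suc u *_) (sum-zero (λ j → zero-term j (J j) refl))) (*-zeroʳ u))) z≤n
          where
          zero-term : ∀ j b → J j ≡ b → χ b * Y i j ≡ 0
          zero-term j false _ = refl
          zero-term j true  e = cong (_+ 0) (n≤0⇒n≡0 (≮⇒≥ (λ pos → none (j , e , pos))))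
        -- A positive entry inside `J` forces `M` to be at most `Y` outside `J` in this row. So `Y`
        -- has at least its share outside `J`, and hence at most its share inside. In the other case
        -- the row of `Y` vanishes on `J`.
        ... | yes (j₁ , Jj₁ , pos) = +-cancelʳ-≤ (out (M i)) _ _ (begin
            suc u * inn (Y i) + out (M i)
              ≤⟨ +-monoʳ-≤ (suc u * inn (Y i)) (≤-trans (sum-mono-≤ λ j → term j (J j) refl) (m≤m+n _ (u * out (Y i)))) ⟩
            suc u * inn (Y i) + suc u * out (Y i)  ≡⟨ *-distribˡ-+ (suc u) (inn (Y i)) _ ⟨
            suc u * (inn (Y i) + out (Y i))        ≡⟨ cong (suc u *_) (trans (split (Y i)) (rows-ok Y-ok i)) ⟩
            suc u * v i                            ≡⟨ trans (split (M i)) (rows i) ⟨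
            inn (M i) + out (M i)                  ∎)
          where
          open ≤-Reasoning
          term : ∀ j b → J j ≡ b → χ (not b) * M i j ≤ χ (not b) * Y i j
          term j true  _ = z≤n
          term j false e = +-monoˡ-≤ 0 (closed i j₁ j Jj₁ e pos)
        swap-sum : ∀ (N : Matrix k l) → sum (λ i → inn (N i)) ≡ inn (colSum N)
        swap-sum N = trans (∑-comm (λ i j → χ (J j) * N i j))
          (sum-cong-≗ λ j → sym (*-distribˡ-sum (χ (J j)) (λ i → N i j)))
        total : inn (colSum Y) ≤ inn w
        total = *-cancelˡ-≤ (suc u) (begin
          suc u * inn (colSum Y)                ≡⟨ cong (suc u *_) (swap-sum Y) ⟨
          suc u * sum (λ i → inn (Y i))         ≡⟨ *-distribˡ-sum (suc u) (λ i → inn (Y i)) ⟩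
          sum (λ i → suc u * inn (Y i))         ≤⟨ sum-mono-≤ row-bound ⟩
          sum (λ i → inn (M i))                 ≡⟨ swap-sum M ⟩
          inn (colSum M)                        ≡⟨ sum-cong-≗ (λ j → trans (cong (χ (J j) *_) (cols j)) (x*yz (χ (J j)) (suc u) (w j))) ⟩
          sum (λ j → suc u * (χ (J j) * w j))   ≡⟨ *-distribˡ-sum (suc u) (λ j → χ (J j) * w j) ⟨
          suc u * inn w                         ∎)
          where
          open ≤-Reasoning
          x*yz : ∀ x y z → x * (y * z) ≡ y * (x * z)
          x*yz = solve-∀
        -- Contradicts `total`: no column of `J` is deficient, and `j₀` lies in `J` with an excess.
        strict : inn w < inn (colSum Y)
        strict = sum-mono-< (λ j → term j (J j) refl) j₀
          (subst (λ b → χ b * w j₀ < χ b * colSum Y j₀) (sym Jj₀) (+-monoˡ-< 0 excess))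
          where
          term : ∀ j b → J j ≡ b → χ b * w j ≤ χ b * colSum Y j
          term j true  e = +-monoˡ-≤ 0 (no-def j e)
          term j false _ = z≤n

      -- `J` is the set of columns reached so far. If it contains a deficient column, that column
      -- ends the path. If it cannot be enlarged, it is closed, which is absurd. Otherwise it gains
      -- a column, so the number of columns outside `J`, which stays below the fuel, drops.
      search : ∀ fuel J → sum (λ j → χ (not (J j))) < fuel → J j₀ ≡ true → (∀ j → J j ≡ true → Shift J j) →
               ∃ λ j → colSum Y j < w j × ∃ λ J → Shift J j
      search (suc fuel) J size Jj₀ reach
        with any? (λ j → (J j ≟ᵇ true) ×-dec (colSum Y j <? w j))
           | any? (λ i → any? λ j₁ → any? λ j₂ → (J j₁ ≟ᵇ true) ×-dec (J j₂ ≟ᵇ false) ×-dec (0 <? Y i j₁) ×-dec (Y i j₂ <? M i j₂))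
      ... | yes (j , Jj , def) | _ = j , def , J , reach j Jj
      ... | no none | no stuck = closed-absurd J Jj₀ (λ j Jj → ≮⇒≥ λ def → none (j , Jj , def))
                                   (λ i j₁ j₂ p q pos → ≮⇒≥ λ lt → stuck (i , j₁ , j₂ , p , q , pos , lt))
      ... | no _ | yes (i , j₁ , j₂ , Jj₁ , Jj₂ , pos , lt) =
        search fuel (insert j₂ J) (≤-trans smaller (≤-pred size)) in-J₀ reach′
        where
        in-J₀ : insert j₂ J j₀ ≡ true
        in-J₀ with j₂ ≟ j₀
        ... | yes _ = refl
        ... | no _  = Jj₀
        reach′ : ∀ j → insert j₂ J j ≡ true → Shift (insert j₂ J) j
        reach′ j e with insert-true j₂ J j e
        ... | inj₁ refl = extend Jj₁ Jj₂ pos lt (reach j₁ Jj₁)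
        ... | inj₂ Jj   = weaken j₂ (reach j Jj)
        fewer : ∀ j → χ (not (insert j₂ J j)) ≤ χ (not (J j))
        fewer j with does (j₂ ≟ j)
        ... | true  = z≤n
        ... | false = ≤-refl
        smaller : sum (λ j → χ (not (insert j₂ J j))) < sum (λ j → χ (not (J j)))
        smaller = sum-mono-< fewer j₂ (subst₂ (λ a b → χ (not (a ∨ J j₂)) < χ (not b)) (sym (dec-true (j₂ ≟ j₂) refl)) (sym Jj₂) ≤-refl)

      augment : ∃ λ j → colSum Y j < w j × ∃ λ J → Shift J j
      augment = search (suc _) (insert j₀ (const false)) ≤-refl in-J₀ reach
        where
        in-J₀ : insert j₀ (const false) j₀ ≡ true
        in-J₀ = cong (_∨ false) (dec-true (j₀ ≟ j₀) refl)
        reach : ∀ j → insert j₀ (const false) j ≡ true → Shift (insert j₀ (const false)) j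
        reach j e with insert-true j₀ (const false) j e
        ... | inj₁ refl = trivial _
        ... | inj₂ ()

    -- Multiplied by `suc u`, both sides count the total weight of `M`. This is why the absence of
    -- excess columns already excludes deficient ones.
    totals : sum v ≡ sum w
    totals = *-cancelˡ-≡ _ _ (suc u) (begin
      suc u * sum v             ≡⟨ *-distribˡ-sum (suc u) v ⟩
      sum (λ i → suc u * v i)   ≡⟨ sum-cong-≗ rows ⟨
      sum (rowSum M)            ≡⟨ ∑-comm M ⟩
      sum (colSum M)            ≡⟨ sum-cong-≗ cols ⟩
      sum (λ j → suc u * w j)   ≡⟨ *-distribˡ-sum (suc u) w ⟨
      suc u * sum w             ∎)
      where open ≡-Reasoning

    Solution : Set
    Solution = Σ (Matrix k l) λ Y → Y ≤ᴹ M × (∀ i → rowSum Y i ≡ v i) × (∀ j → colSum Y j ≡ w j)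

    -- The total excess, counted by truncated differences, drops with every augmentation: column
    -- `j₀` loses one unit, and the receiving column was deficient.
    repair : ∀ fuel Y → Partial Y → sum (λ j → colSum Y j ∸ w j) < fuel → Solution
    repair (suc fuel) Y Y-ok size with any? (λ j → w j <? colSum Y j)
    ... | no none = Y , bounded Y-ok , rows-ok Y-ok , sum-≤-≡⇒≗ (λ j → ≮⇒≥ λ e → none (j , e))
          (trans (sym (∑-comm Y)) (trans (sum-cong-≗ (rows-ok Y-ok)) totals))
    ... | yes (j₀ , excess) with Augment.augment Y Y-ok j₀ excess
    ... | j , deficit , J , S = repair fuel Y′ partial (≤-trans smaller (≤-pred size))
      where
      open Augment Y Y-ok j₀ excess
      open Shift S
      pointwise : ∀ j′ → (colSum Y′ j′ ∸ w j′) + δ j₀ j′ ≤ colSum Y j′ ∸ w j′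
      pointwise j′ with j₀ ≟ j′ | j ≟ j′ | shifted j′
      ... | yes refl | yes refl | _ = contradiction deficit (<⇒≯ excess)
      ... | yes refl | no _     | e = ≤-reflexive (trans (sym (+-∸-comm 1 w≤Y′)) (cong (_∸ w j₀) (trans e (+-identityʳ _))))
        where
        w≤Y′ : w j₀ ≤ colSum Y′ j₀
        w≤Y′ = ≤-pred (≤-trans excess (≤-reflexive (trans (sym (trans e (+-identityʳ _))) (+-comm _ 1))))
      -- The receiving column was strictly below `w`, so after gaining one unit it still has excess
      -- zero.
      ... | no _     | yes refl | e = ≤-trans (≤-reflexive (trans (+-identityʳ _) (m≤n⇒m∸n≡0
              (≤-trans (≤-reflexive (trans (sym (+-identityʳ _)) (trans e (+-comm _ 1)))) deficit)))) z≤n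
      ... | no _     | no _     | e = ≤-reflexive (trans (+-identityʳ _)
              (cong (_∸ w j′) (trans (sym (+-identityʳ _)) (trans e (+-identityʳ _)))))
      smaller : sum (λ j → colSum Y′ j ∸ w j) < sum (λ j → colSum Y j ∸ w j)
      smaller = begin-strict
        sum (λ j → colSum Y′ j ∸ w j)                   <⟨ n<1+n _ ⟩
        1 + sum (λ j → colSum Y′ j ∸ w j)               ≡⟨ +-comm 1 _ ⟩
        sum (λ j → colSum Y′ j ∸ w j) + 1               ≡⟨ cong (sum (λ j → colSum Y′ j ∸ w j) +_) (sum-δ j₀) ⟨
        sum (λ j → colSum Y′ j ∸ w j) + sum (δ j₀)      ≡⟨ ∑-distrib-+ (λ j → colSum Y′ j ∸ w j) (δ j₀) ⟨
        sum (λ j → (colSum Y′ j ∸ w j) + δ j₀ j)        ≤⟨ sum-mono-≤ pointwise ⟩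
        sum (λ j → colSum Y j ∸ w j)                    ∎
        where open ≤-Reasoning

    solution : Solution
    solution = repair (suc _) (λ i → proj₁ (start i)) record
      { bounded = λ i → proj₁ (proj₂ (start i)) ; rows-ok = λ i → proj₂ (proj₂ (start i)) } ≤-refl
      where
      start : ∀ i → Σ (Vector ℕ l) λ g → (∀ j → g j ≤ M i j) × sum g ≡ v i
      start i = subvector (M i) (≤-trans (m≤m+n (v i) (u * v i)) (≤-reflexive (sym (rows i))))

  rowSum-∸ : {Y M : Matrix k l} → Y ≤ᴹ M → ∀ i → rowSum (λ i j → M i j ∸ Y i j) i + rowSum Y i ≡ rowSum M i
  rowSum-∸ {Y = Y} {M} Y≤M i = trans (sym (∑-distrib-+ (λ j → M i j ∸ Y i j) (Y i)))
    (sum-cong-≗ λ j → m∸n+n≡m (Y≤M i j))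

  -- Peel off one solution; the remainder satisfies the same hypotheses with `u` lowered by one.
  -- With `v` and `w` constantly 1 this is the splitting of a regular bipartite multigraph into
  -- perfect matchings.
  decompose : ∀ u (M : Matrix k l) (v : Vector ℕ k) (w : Vector ℕ l) → (∀ i → rowSum M i ≡ u * v i) → (∀ j → colSum M j ≡ u * w j) →
    Σ (Fin u → Matrix k l) λ Y → (∀ t i → rowSum (Y t) i ≡ v i) × (∀ t j → colSum (Y t) j ≡ w j) ×
      (∀ i j → sum (λ t → Y t i j) ≡ M i j)
  decompose zero M v w rows cols = (λ ()) , (λ ()) , (λ ()) ,
    λ i j → sym (n≤0⇒n≡0 (≤-trans (term≤sum (M i) j) (≤-reflexive (rows i))))
  decompose (suc u) M v w rows cols with Splitting.solution M v w u rows cols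
  ... | Y , Y≤M , Y-rows , Y-cols with decompose u (λ i j → M i j ∸ Y i j) v w
      (λ i → +-cancelˡ-≡ (v i) _ _ (trans (+-comm (v i) _)
        (trans (cong (rowSum (λ i j → M i j ∸ Y i j) i +_) (sym (Y-rows i))) (trans (rowSum-∸ Y≤M i) (rows i)))))
      (λ j → +-cancelˡ-≡ (w j) _ _ (trans (+-comm (w j) _)
        (trans (cong (colSum (λ i j → M i j ∸ Y i j) j +_) (sym (Y-cols j)))
          (trans (rowSum-∸ {Y = λ j i → Y i j} {λ j i → M i j} (λ j i → Y≤M i j) j) (cols j)))))
  ... | Z , Z-rows , Z-cols , Z-sum =
    (λ { zero → Y ; (suc t) → Z t }) , (λ { zero → Y-rows ; (suc t) → Z-rows t }) ,
    (λ { zero → Y-cols ; (suc t) → Z-cols t }) ,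
    λ i j → trans (cong (Y i j +_) (Z-sum i j)) (m+[n∸m]≡n (Y≤M i j))

  -- Amalgamation

  class : (p : Vector ℕ m) → Fin (sum p) → Fin m
  class {suc m} p t = [ const zero , suc ∘ class (tail p) ]′ (splitAt (p zero) t)

  sum-class : (p : Vector ℕ m) (f : Vector ℕ m) → sum (f ∘ class p) ≡ sum (λ x → p x * f x)
  sum-class {zero}  p f = refl
  sum-class {suc m} p f = trans (sum-split (p zero) (f ∘ class p)) (cong₂ _+_
    (trans (sum-cong-≗ λ t → cong (f ∘ [ const zero , suc ∘ class (tail p) ]′) (splitAt-↑ˡ (p zero) t (sum (tail p))))
      (sum-const (p zero) (f zero)))
    (trans (sum-cong-≗ λ t → cong (f ∘ [ const zero , suc ∘ class (tail p) ]′) (splitAt-↑ʳ (p zero) (sum (tail p)) t))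
      (sum-class (tail p) (f ∘ suc))))

  -- Each layer `M x` is decomposed into `p x` layers, one for every element of its class. The sums
  -- across layers are preserved, so the next direction can be split in turn. The final bound keeps
  -- the support inside that of the original array.
  disaggregate : (p : Vector ℕ m) (M : Fin m → Matrix k l) (v : Vector ℕ k) (w : Vector ℕ l) →
    (∀ x i → rowSum (M x) i ≡ p x * v i) → (∀ x j → colSum (M x) j ≡ p x * w j) →
    Σ (Fin (sum p) → Matrix k l) λ Y →
      (∀ t i → rowSum (Y t) i ≡ v i) × (∀ t j → colSum (Y t) j ≡ w j) ×
      (∀ i j → sum (λ t → Y t i j) ≡ sum (λ x → M x i j)) × (∀ t → Y t ≤ᴹ M (class p t))
  disaggregate {zero}  p M v w rows cols = (λ ()) , (λ ()) , (λ ()) , (λ _ _ → refl) , λ ()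
  disaggregate {suc m} p M v w rows cols
    with decompose (p zero) (M zero) v w (rows zero) (cols zero)
       | disaggregate (tail p) (tail M) v w (rows ∘ suc) (cols ∘ suc)
  ... | Y , Y-rows , Y-cols , Y-sum | Z , Z-rows , Z-cols , Z-sum , Z≤M =
    (λ t → YZ (splitAt (p zero) t)) , (λ t → YZ-rows (splitAt (p zero) t)) , (λ t → YZ-cols (splitAt (p zero) t)) ,
    (λ i j → trans (sum-split (p zero) (λ t → YZ (splitAt (p zero) t) i j)) (cong₂ _+_
      (trans (sum-cong-≗ λ t → cong (λ s → YZ s i j) (splitAt-↑ˡ (p zero) t (sum (tail p)))) (Y-sum i j))
      (trans (sum-cong-≗ λ t → cong (λ s → YZ s i j) (splitAt-↑ʳ (p zero) (sum (tail p)) t)) (Z-sum i j)))) ,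
    λ t → YZ≤M (splitAt (p zero) t)
    where
    YZ : Fin (p zero) ⊎ Fin (sum (tail p)) → Matrix _ _
    YZ = [ Y , Z ]′
    YZ-rows : ∀ s i → rowSum (YZ s) i ≡ v i
    YZ-rows (inj₁ t) = Y-rows t
    YZ-rows (inj₂ t) = Z-rows t
    YZ-cols : ∀ s j → colSum (YZ s) j ≡ w j
    YZ-cols (inj₁ t) = Y-cols t
    YZ-cols (inj₂ t) = Z-cols t
    YZ≤M : ∀ s → YZ s ≤ᴹ M ([ const zero , suc ∘ class (tail p) ]′ s)
    YZ≤M (inj₁ t) i j = ≤-trans (term≤sum (λ t → Y t i j) t) (≤-reflexive (Y-sum i j))
    YZ≤M (inj₂ t) = Z≤M t

  sum≡1⇒unique-support : (f : Vector ℕ n) → sum f ≡ 1 → ∃ λ i → 0 < f i × (∀ j → 0 < f j → i ≡ j)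
  sum≡1⇒unique-support {suc n} f eq with f zero in f₀
  ... | suc a = zero , subst (0 <_) (sym f₀) (s≤s z≤n) , λ where
    zero    _   → refl
    (suc j) pos → contradiction (≤-trans pos (≤-trans (term≤sum (tail f) j)
                    (≤-trans (m≤n+m _ a) (≤-reflexive (suc-injective eq))))) λ ()
  ... | zero with sum≡1⇒unique-support (tail f) eq
  ... | i , pos , uniq = suc i , pos , λ where
    zero    pos′ → contradiction (subst (0 <_) f₀ pos′) λ ()
    (suc j) pos′ → cong suc (uniq j pos′)

  -- Hilton's amalgamation theorem: an outline latin square x, whose (i , j , k) entry counts the
  -- cells of block (i , j) with a symbol of class k, is the quotient of a latin square.
  amalgamation : (p : Vector ℕ m) (x : Fin m → Fin m → Fin m → ℕ) →
    (∀ j k → sum (λ i → x i j k) ≡ p j * p k) →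
    (∀ i k → sum (λ j → x i j k) ≡ p i * p k) →
    (∀ i j → sum (λ k → x i j k) ≡ p i * p j) →
    Σ (Square (sum p)) λ L → IsLatin L ×
      (∀ r c → 0 < x (class p r) (class p c) (class p (L r c)))
  amalgamation p x sum₁ sum₂ sum₃
    with disaggregate p x p p sum₃ sum₂
  ... | Y , Y-rows , Y-cols , Y-sum , Y≤x
    -- Rows are now single. A row meets column class `j` in `p j` cells, so after splitting the
    -- columns each cell holds exactly one symbol: hence `const 1`.
    with disaggregate p (λ j r k → Y r j k) (const 1) p
           (λ j r → trans (Y-rows r j) (sym (*-identityʳ _))) (λ j k → trans (Y-sum j k) (sum₁ j k))
  ... | Z , Z-rows , Z-cols , Z-sum , Z≤Y
    -- Splitting the symbols makes every line sum 1 in all three directions, so `W` is the indicator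
    -- array of a latin square, indexed by symbol, column, row.
    with disaggregate p (λ k c r → Z c r k) (const 1) (const 1)
           (λ k c → trans (Z-cols c k) (sym (*-identityʳ _)))
           (λ k r → trans (Z-sum r k) (trans (Y-cols r k) (sym (*-identityʳ _))))
  ... | W , W-rows , W-cols , W-sum , W≤Z =
    L , record
      { row-once = λ r s → let (c , pos , uniq) = sum≡1⇒unique-support (λ c → W s c r) (W-cols s r) in
          (c , W⇒L pos) , λ c₁ c₂ e₁ e₂ → trans (sym (uniq c₁ (L⇒W e₁))) (uniq c₂ (L⇒W e₂))
      ; col-once = λ c s → let (r , pos , uniq) = sum≡1⇒unique-support (λ r → W s c r) (W-rows s c) in
          (r , W⇒L pos) , λ r₁ r₂ e₁ e₂ → trans (sym (uniq r₁ (L⇒W e₁))) (uniq r₂ (L⇒W e₂))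
      } ,
    -- A positive entry of `W` stays positive when traced back through the three splittings to `x`.
    λ r c → ≤-trans (L⇒W refl) (≤-trans (W≤Z (L r c) c r) (≤-trans (Z≤Y c r _) (Y≤x r _ _)))
    where
    cell : ∀ r c → ∃ λ s → 0 < W s c r × (∀ s′ → 0 < W s′ c r → s ≡ s′)
    cell r c = sum≡1⇒unique-support (λ s → W s c r) (trans (W-sum c r) (Z-rows c r))
    L : Square (sum p)
    L r c = proj₁ (cell r c)
    L⇒W : ∀ {r c s} → L r c ≡ s → 0 < W s c r
    L⇒W {r} {c} refl = proj₁ (proj₂ (cell r c))
    W⇒L : ∀ {r c s} → 0 < W s c r → L r c ≡ s
    W⇒L {r} {c} {s} = proj₂ (proj₂ (cell r c)) s

  -- Subsquares as unions of classes

  ∣tabulate∣ : (f : Fin n → Bool) → ∣ tabulate f ∣ ≡ sum (χ ∘ f)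
  ∣tabulate∣ {zero}  f = refl
  ∣tabulate∣ {suc n} f with f zero
  ... | true  = cong suc (∣tabulate∣ (f ∘ suc))
  ... | false = ∣tabulate∣ (f ∘ suc)

  ∩-tabulate : (f g : Fin n → Bool) → tabulate f ∩ tabulate g ≡ tabulate (λ i → f i ∧ g i)
  ∩-tabulate {zero}  f g = refl
  ∩-tabulate {suc n} f g = cong ((f zero ∧ g zero) Vec.∷_) (∩-tabulate (f ∘ suc) (g ∘ suc))

  ∈-tabulate⁺ : (f : Fin n → Bool) → ∀ {i} → f i ≡ true → i ∈ tabulate f
  ∈-tabulate⁺ f {i} e = lookup⇒[]= i (tabulate f) (trans (lookup∘tabulate f i) e)

  ∈-tabulate⁻ : (f : Fin n → Bool) → ∀ {i} → i ∈ tabulate f → f i ≡ true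
  ∈-tabulate⁻ f {i} i∈ = trans (sym (lookup∘tabulate f i)) ([]=⇒lookup i∈)

  -- On the support of `x`, two indices in `T` force the third. This makes the union of the classes
  -- in `T` a subsquare of every latin square supported on `x`.
  record Closed (x : Fin m → Fin m → Fin m → ℕ) (T : Fin m → Bool) : Set where
    field
      rows-cols : ∀ i j k → 0 < x i j k → T i ≡ true → T j ≡ true → T k ≡ true
      rows-syms : ∀ i j k → 0 < x i j k → T i ≡ true → T k ≡ true → T j ≡ true
      cols-syms : ∀ i j k → 0 < x i j k → T j ≡ true → T k ≡ true → T i ≡ true

  union-of-classes : (p : Vector ℕ m) → (Fin m → Bool) → Subset (sum p)
  union-of-classes p T = tabulate (T ∘ class p)

  -- Existence and uniqueness of the required cell come from `L` itself; closedness only places it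
  -- inside the union.
  closed⇒subsquare : ∀ (p : Vector ℕ m) {x L T} → IsLatin L →
    (∀ r c → 0 < x (class p r) (class p c) (class p (L r c))) → Closed x T →
    IsSubsquare L (union-of-classes p T) (union-of-classes p T) (sum (λ i → p i * χ (T i)))
  closed⇒subsquare p {x} {L} {T} latin supp closed = record
    { symbols    = union-of-classes p T
    ; rows-size  = size ; cols-size = size ; syms-size = size
    ; entries-in = λ r c r∈ c∈ → i∈ (rows-cols _ _ _ (supp r c) (∈i r∈) (∈i c∈))
    ; row-once   = λ r s r∈ s∈ → let ((c , e) , uniq) = row-once r s in
        (c , i∈ (rows-syms _ _ _ (supp r c) (∈i r∈) (subst (λ s → T (class p s) ≡ true) (sym e) (∈i s∈))) , e) ,
        λ c₁ c₂ _ _ → uniq c₁ c₂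
    ; col-once   = λ c s c∈ s∈ → let ((r , e) , uniq) = col-once c s in
        (r , i∈ (cols-syms _ _ _ (supp r c) (∈i c∈) (subst (λ s → T (class p s) ≡ true) (sym e) (∈i s∈))) , e) ,
        λ r₁ r₂ _ _ → uniq r₁ r₂
    }
    where
    open Closed closed
    open IsLatin latin
    i∈ : ∀ {r} → T (class p r) ≡ true → r ∈ union-of-classes p T
    i∈ = ∈-tabulate⁺ (T ∘ class p)
    ∈i : ∀ {r} → r ∈ union-of-classes p T → T (class p r) ≡ true
    ∈i = ∈-tabulate⁻ (T ∘ class p)
    size : ∣ union-of-classes p T ∣ ≡ sum (λ i → p i * χ (T i))
    size = trans (∣tabulate∣ (T ∘ class p)) (sum-class p (χ ∘ T))

  -- Under total symmetry the three closure conditions are one and the same, so it is enough to see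
  -- that the entries violating it vanish.
  symmetric⇒Closed : {x : Fin m → Fin m → Fin m → ℕ} {T : Fin m → Bool} →
    (∀ i j k → x i j k ≡ x j i k) → (∀ i j k → x i j k ≡ x j k i) →
    (∀ i j k → T i ≡ true → T j ≡ true → T k ≡ false → x i j k ≡ 0) → Closed x T
  symmetric⇒Closed {x = x} {T} swap rotate vanish = record
    { rows-cols = third
    ; rows-syms = λ i j k pos Ti Tk → third k i j (subst (0 <_) (sym (rotate k i j)) pos) Tk Ti
    ; cols-syms = λ i j k pos Tj Tk → third j k i (subst (0 <_) (rotate i j k) pos) Tj Tk
    }
    where
    third : ∀ i j k → 0 < x i j k → T i ≡ true → T j ≡ true → T k ≡ true
    third i j k pos Ti Tj with T k in Tk
    ... | true  = refl
    ... | false = contradiction (subst (0 <_) (vanish i j k Ti Tj Tk) pos) λ ()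

  Closed-∧ : {x : Fin m → Fin m → Fin m → ℕ} {S T : Fin m → Bool} →
    Closed x S → Closed x T → Closed x (λ i → S i ∧ T i)
  Closed-∧ {S = S} {T} s t = record
    { rows-cols = λ i j k pos → ∧-intro (S i) (T i) (S j) (T j) (S.rows-cols i j k pos) (T.rows-cols i j k pos)
    ; rows-syms = λ i j k pos → ∧-intro (S i) (T i) (S k) (T k) (S.rows-syms i j k pos) (T.rows-syms i j k pos)
    ; cols-syms = λ i j k pos → ∧-intro (S j) (T j) (S k) (T k) (S.cols-syms i j k pos) (T.cols-syms i j k pos)
    }
    where
    module S = Closed s
    module T = Closed t
    ∧-intro : ∀ a b a′ b′ {a″ b″} → (a ≡ true → a′ ≡ true → a″ ≡ true) → (b ≡ true → b′ ≡ true → b″ ≡ true) →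
           a ∧ b ≡ true → a′ ∧ b′ ≡ true → a″ ∧ b″ ≡ true
    ∧-intro true true true true f g _ _ = cong₂ _∧_ (f refl refl) (g refl refl)

  weight : Vector ℕ m → (Fin m → Bool) → ℕ
  weight p T = sum (λ i → p i * χ (T i))

  outline⇒configuration : (p : Vector ℕ m) (x : Fin m → Fin m → Fin m → ℕ) {S T : Fin m → Bool} →
    (∀ i j k → x i j k ≡ x j i k) → (∀ i j k → x i j k ≡ x j k i) →
    (∀ i j → sum (λ k → x i j k) ≡ p i * p j) → Closed x S → Closed x T →
    HasConfiguration (sum p) (weight p S) (weight p T) (weight p (λ i → S i ∧ T i))
  outline⇒configuration p x {S} {T} swap rotate line closed-S closed-T
    with amalgamation p x
      (λ j k → trans (sum-cong-≗ λ i → rotate i j k) (line j k))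
      (λ i k → trans (sum-cong-≗ λ j → trans (swap i j k) (rotate j i k)) (line i k))
      line
  ... | L , latin , supp =
    L , latin , U S , U S , U T , U T ,
    closed⇒subsquare p latin supp closed-S , closed⇒subsquare p latin supp closed-T ,
    subst (λ V → IsSubsquare L V V (weight p (λ i → S i ∧ T i))) (sym (∩-tabulate (S ∘ class p) (T ∘ class p)))
      (closed⇒subsquare p latin supp (Closed-∧ closed-S closed-T))
    where
    U = union-of-classes p

  -- The outline square forced by two subsquares

  -- Classes 0F, 1F, 2F, 3F: both subsquares, only the first, only the second, neither.
  -- The hypotheses force every entry of the outline square.
  module Outline (c e f g h E d : ℕ) (d≡q+g : d ≡ c + f + g) (d≡p+h : d ≡ c + e + h)
    (E-def : E + d * (c + (c + e) + (c + f)) ≡ d * d + 2 * ((c + e) * (c + f))) where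

    p q : ℕ
    p = c + e
    q = c + f

    size : Vector ℕ 4
    size = c ∷ p ∷ q ∷ d ∷ []

    -- The entries depend only on how often the classes 1F, 2F, 3F occur among the indices.
    entry : ℕ → ℕ → ℕ → ℕ
    entry 0 0 0 = c * c
    entry 2 0 0 = c * p
    entry 3 0 0 = p * e
    entry 0 2 0 = c * q
    entry 0 3 0 = q * f
    entry 1 1 1 = p * q
    entry 0 0 2 = c * d
    entry 1 0 2 = p * g
    entry 0 1 2 = q * h
    -- The line through (`3F`, `3F`) must total `d * d`, which forces the value prescribed by
    -- `E-def`. That this value is nonnegative is the third numerical condition.
    entry 0 0 3 = E
    entry _ _ _ = 0

    count : Fin 4 → Fin 4 → Fin 4 → Fin 4 → ℕ
    count t i j k = δ t i + δ t j + δ t k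

    x : Fin 4 → Fin 4 → Fin 4 → ℕ
    x i j k = entry (count 1F i j k) (count 2F i j k) (count 3F i j k)

    entry-cong : ∀ {i j k i′ j′ k′} → (∀ t → count t i j k ≡ count t i′ j′ k′) → x i j k ≡ x i′ j′ k′
    entry-cong {i} {j} {k} {i′} {j′} {k′} eq = trans
      (cong₂ (λ a b → entry a b (count 3F i j k)) (eq 1F) (eq 2F))
      (cong (entry (count 1F i′ j′ k′) (count 2F i′ j′ k′)) (eq 3F))

    x-swap : ∀ i j k → x i j k ≡ x j i k
    x-swap i j k = entry-cong {i} {j} {k} {j} {i} {k} λ t → cong (_+ δ t k) (+-comm (δ t i) (δ t j))

    x-rotate : ∀ i j k → x i j k ≡ x j k i
    x-rotate i j k = entry-cong {i} {j} {k} {j} {k} {i} λ t → trans (+-assoc (δ t i) _ _) (+-comm (δ t i) _)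

    line : ∀ i j → sum (λ k → x i j k) ≡ size i * size j
    line 0F 0F = +-identityʳ _
    line 0F 1F = +-identityʳ _
    line 0F 2F = +-identityʳ _
    line 0F 3F = +-identityʳ _
    line 1F 1F = lem c e
      where
      lem : ∀ c e → c * (c + e) + ((c + e) * e + 0) ≡ (c + e) * (c + e)
      lem = solve-∀
    line 1F 2F = +-identityʳ _
    line 1F 3F = trans (lem p q g) (cong (p *_) (sym d≡q+g))
      where
      lem : ∀ p q g → p * q + (p * g + 0) ≡ p * (q + g)
      lem = solve-∀
    line 2F 2F = lem c f
      where
      lem : ∀ c f → c * (c + f) + ((c + f) * f + 0) ≡ (c + f) * (c + f)
      lem = solve-∀
    line 2F 3F = trans (lem p q h) (cong (q *_) (sym d≡p+h))
      where
      lem : ∀ p q h → p * q + (q * h + 0) ≡ q * (p + h)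
      lem = solve-∀
    -- Adding `p * q` twice completes `p * g` to `p * d` and `q * h` to `q * d`.
    line 3F 3F = +-cancelʳ-≡ (2 * (p * q)) _ _ (begin
      c * d + (p * g + (q * h + (E + 0))) + 2 * (p * q)  ≡⟨ lem c p q d g h E ⟩
      c * d + p * (q + g) + q * (p + h) + E              ≡⟨ cong₂ (λ a b → c * d + p * a + q * b + E) (sym d≡q+g) (sym d≡p+h) ⟩
      c * d + p * d + q * d + E                          ≡⟨ lem′ c p q d E ⟩
      E + d * (c + p + q)                                ≡⟨ E-def ⟩
      d * d + 2 * (p * q)                                ∎)
      where
      open ≡-Reasoning
      lem : ∀ c p q d g h E → c * d + (p * g + (q * h + (E + 0))) + 2 * (p * q)
              ≡ c * d + p * (q + g) + q * (p + h) + E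
      lem = solve-∀
      lem′ : ∀ c p q d E → c * d + p * d + q * d + E ≡ E + d * (c + p + q)
      lem′ = solve-∀
    line 1F 0F = trans (line 0F 1F) (*-comm c p)
    line 2F 0F = trans (line 0F 2F) (*-comm c q)
    line 3F 0F = trans (line 0F 3F) (*-comm c d)
    line 2F 1F = trans (line 1F 2F) (*-comm p q)
    line 3F 1F = trans (line 1F 3F) (*-comm p d)
    line 3F 2F = trans (line 2F 3F) (*-comm q d)

    first second : Fin 4 → Bool
    first 0F  = true
    first 1F  = true
    first _   = false
    second 0F = true
    second 2F = true
    second _  = false

    Closed-first : Closed x first
    Closed-first = symmetric⇒Closed x-swap x-rotate λ where
      0F 0F 2F _ _ _ → refl
      0F 0F 3F _ _ _ → refl
      0F 1F 2F _ _ _ → refl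
      0F 1F 3F _ _ _ → refl
      1F 0F 2F _ _ _ → refl
      1F 0F 3F _ _ _ → refl
      1F 1F 2F _ _ _ → refl
      1F 1F 3F _ _ _ → refl

    Closed-second : Closed x second
    Closed-second = symmetric⇒Closed x-swap x-rotate λ where
      0F 0F 1F _ _ _ → refl
      0F 0F 3F _ _ _ → refl
      0F 2F 1F _ _ _ → refl
      0F 2F 3F _ _ _ → refl
      2F 0F 1F _ _ _ → refl
      2F 0F 3F _ _ _ → refl
      2F 2F 1F _ _ _ → refl
      2F 2F 3F _ _ _ → refl

    configuration : HasConfiguration (c + p + q + d) (c + p) (c + q) c
    configuration = cast (lem₀ c p q d) (lem₁ c p q d) (lem₂ c p q d) (lem₃ c p q d)
      (outline⇒configuration size x x-swap x-rotate line Closed-first Closed-second)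
      where
      lem₀ : ∀ c p q d → c + (p + (q + (d + 0))) ≡ c + p + q + d
      lem₀ = solve-∀
      lem₁ : ∀ c p q d → c * 1 + (p * 1 + (q * 0 + (d * 0 + 0))) ≡ c + p
      lem₁ = solve-∀
      lem₂ : ∀ c p q d → c * 1 + (p * 0 + (q * 1 + (d * 0 + 0))) ≡ c + q
      lem₂ = solve-∀
      lem₃ : ∀ c p q d → c * 1 + (p * 0 + (q * 0 + (d * 0 + 0))) ≡ c
      lem₃ = solve-∀
      cast : ∀ {n n′ a a′ b b′ c c′} → n ≡ n′ → a ≡ a′ → b ≡ b′ → c ≡ c′ →
             HasConfiguration n a b c → HasConfiguration n′ a′ b′ c′
      cast refl refl refl refl config = config

  -- Counting cells of a given square

  all-Bool? : ∀ {P : Bool → Set} → (∀ b → Dec (P b)) → Dec (∀ b → P b)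
  all-Bool? P? = map′ (λ { (t , f) true → t ; (t , f) false → f }) (λ all → all true , all false) (P? true ×-dec P? false)

  both onlyˡ onlyʳ neither : Bool → Bool → ℕ
  both    x y = χ (x ∧ y)
  onlyˡ   x y = χ (x ∧ not y)
  onlyʳ   x y = χ (not x ∧ y)
  neither x y = χ (not x ∧ not y)

  -- All that the counting uses about a cell and a subsquare: of the memberships of its row, column
  -- and symbol, never exactly two hold.
  notTwo : Bool → Bool → Bool → Bool
  notTwo true  true  z     = z
  notTwo true  false z     = not z
  notTwo false true  z     = not z
  notTwo false false _     = true

  module _ {n} {L : Square n} (latin : IsLatin L) where
    private module L = IsLatin latin

    row-permutation : Fin n → Permutation′ n
    row-permutation r = permutation (L r) (λ s → proj₁ (proj₁ (L.row-once r s)))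
      (λ s → proj₂ (proj₁ (L.row-once r s)))
      (λ c → proj₂ (L.row-once r (L r c)) _ c (proj₂ (proj₁ (L.row-once r (L r c)))) refl)

    col-permutation : Fin n → Permutation′ n
    col-permutation c = permutation (λ r → L r c) (λ s → proj₁ (proj₁ (L.col-once c s)))
      (λ s → proj₂ (proj₁ (L.col-once c s)))
      (λ r → proj₂ (L.col-once c (L r c)) _ r (proj₂ (proj₁ (L.col-once c (L r c)))) refl)

    cells : (Fin n → Fin n → Fin n → ℕ) → ℕ
    cells f = sum (λ r → sum (λ c → f r c (L r c)))

    cells-mono : ∀ {f g} → (∀ r c → f r c (L r c) ≤ g r c (L r c)) → cells f ≤ cells g
    cells-mono f≤g = sum-mono-≤ λ r → sum-mono-≤ λ c → f≤g r c

    cells-+ : ∀ f g → cells (λ r c s → f r c s + g r c s) ≡ cells f + cells g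
    cells-+ f g = trans (sum-cong-≗ λ r → ∑-distrib-+ (λ c → f r c (L r c)) (λ c → g r c (L r c)))
      (∑-distrib-+ (λ r → sum (λ c → f r c (L r c))) (λ r → sum (λ c → g r c (L r c))))

    module _ (α β : Vector ℕ n) where

      cells-rows-cols : cells (λ r c s → α r * β c) ≡ sum α * sum β
      cells-rows-cols = trans (sum-cong-≗ λ r → sym (*-distribˡ-sum (α r) β)) (sym (*-distribʳ-sum (sum β) α))

      cells-rows-syms : cells (λ r c s → α r * β s) ≡ sum α * sum β
      cells-rows-syms = trans
        (sum-cong-≗ λ r → trans (sym (*-distribˡ-sum (α r) (λ c → β (L r c))))
          (cong (α r *_) (sym (sum-permute β (row-permutation r)))))
        (sym (*-distribʳ-sum (sum β) α))

      cells-cols-syms : cells (λ r c s → α c * β s) ≡ sum α * sum β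
      cells-cols-syms = trans (∑-comm (λ r c → α c * β (L r c)))
        (trans
          (sum-cong-≗ λ c → trans (sym (*-distribˡ-sum (α c) (λ r → β (L r c))))
            (cong (α c *_) (sym (sum-permute β (col-permutation c)))))
          (sym (*-distribʳ-sum (sum β) α)))

    -- A symbol of the subsquare already occurs inside it in each of its rows and columns, and by
    -- latinness nowhere else on that line.
    subsquare⇒notTwo : ∀ {R C k} (S : IsSubsquare L R C k) → ∀ r c →
      notTwo (lookup R r) (lookup C c) (lookup (IsSubsquare.symbols S) (L r c)) ≡ true
    subsquare⇒notTwo {R} {C} S r c
      with lookup R r in r∈ | lookup C c in c∈ | lookup (IsSubsquare.symbols S) (L r c) in s∈
    ... | true  | true  | true  = refl
    ... | true  | true  | false = trans (sym s∈) ([]=⇒lookup (S.entries-in r c (lookup⇒[]= r R r∈) (lookup⇒[]= c C c∈)))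
      where module S = IsSubsquare S
    ... | true  | false | false = refl
    ... | true  | false | true  with proj₁ (S.row-once r (L r c) (lookup⇒[]= r R r∈) (lookup⇒[]= _ S.symbols s∈))
      where module S = IsSubsquare S
    ...   | c′ , c′∈ , e with proj₂ (L.row-once r (L r c)) c c′ refl e
    ...     | refl = trans (sym c∈) ([]=⇒lookup c′∈)
    subsquare⇒notTwo {R} {C} S r c
        | false | true  | false = refl
    subsquare⇒notTwo {R} {C} S r c
        | false | true  | true  with proj₁ (S.col-once c (L r c) (lookup⇒[]= c C c∈) (lookup⇒[]= _ S.symbols s∈))
      where module S = IsSubsquare S
    ...   | r′ , r′∈ , e with proj₂ (L.col-once c (L r c)) r r′ refl e
    ...     | refl = trans (sym r∈) ([]=⇒lookup r′∈)
    subsquare⇒notTwo {R} {C} S r c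
        | false | false | _     = refl

  ∣∣≡sum : (R : Subset n) → ∣ R ∣ ≡ sum (χ ∘ lookup R)
  ∣∣≡sum Vec.[]          = refl
  ∣∣≡sum (true  Vec.∷ R) = cong suc (∣∣≡sum R)
  ∣∣≡sum (false Vec.∷ R) = ∣∣≡sum R

  nonempty : {R : Subset n} → 0 < ∣ R ∣ → ∃ λ r → r ∈ R
  nonempty {n} {R} pos with nonempty? R
  ... | yes ne = ne
  ... | no ¬ne = contradiction (subst (0 <_) (trans (cong ∣_∣ (Empty-unique ¬ne)) (∣⊥∣≡0 n)) pos) λ ()

  record Sizes (f g : Fin n → Bool) (c p q d : ℕ) : Set where
    field
      size-both    : sum (λ i → both (f i) (g i)) ≡ c
      size-onlyˡ   : sum (λ i → onlyˡ (f i) (g i)) ≡ p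
      size-onlyʳ   : sum (λ i → onlyʳ (f i) (g i)) ≡ q
      size-neither : sum (λ i → neither (f i) (g i)) ≡ d

    size-either : sum (λ i → χ (f i ∨ g i)) ≡ c + p + q
    size-either = begin
      sum (λ i → χ (f i ∨ g i))                                               ≡⟨ sum-cong-≗ (λ i → pointwise (f i) (g i)) ⟩
      sum (λ i → both (f i) (g i) + onlyˡ (f i) (g i) + onlyʳ (f i) (g i))    ≡⟨ ∑-distrib-+ (λ i → both (f i) (g i) + onlyˡ (f i) (g i)) _ ⟩
      sum (λ i → both (f i) (g i) + onlyˡ (f i) (g i)) + sum (λ i → onlyʳ (f i) (g i))
        ≡⟨ cong₂ _+_ (trans (∑-distrib-+ (λ i → both (f i) (g i)) _) (cong₂ _+_ size-both size-onlyˡ)) size-onlyʳ ⟩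
      c + p + q                                                               ∎
      where
      open ≡-Reasoning
      pointwise : ∀ x y → χ (x ∨ y) ≡ both x y + onlyˡ x y + onlyʳ x y
      pointwise = from-yes (all-Bool? λ x → all-Bool? λ y → χ (x ∨ y) ≟ⁿ both x y + onlyˡ x y + onlyʳ x y)

  sum-+-≡ : {f g h : Vector ℕ n} → (∀ i → f i ≡ g i + h i) → sum f ≡ sum g + sum h
  sum-+-≡ {g = g} {h} eq = trans (sum-cong-≗ eq) (∑-distrib-+ g h)

  -- The fourth size is written `n ∸ (c + p + q)` so that rows, columns and symbols share the same
  -- number; the accompanying equation shows that nothing is truncated.
  sizes : ∀ {c p q} (f g : Fin n → Bool) → sum (χ ∘ f) ≡ c + p → sum (χ ∘ g) ≡ c + q →
    sum (λ i → χ (f i ∧ g i)) ≡ c → Sizes f g c p q (n ∸ (c + p + q)) × n ≡ c + p + q + (n ∸ (c + p + q))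
  sizes {n} {c} {p} {q} f g ∣f∣ ∣g∣ ∣f∧g∣ = S , trans n≡ (cong (c + p + q +_) (size-neither S))
    where
    open Sizes
    only-l : sum (λ i → onlyˡ (f i) (g i)) ≡ p
    only-l = +-cancelˡ-≡ c _ _ (trans (cong (_+ _) (sym ∣f∧g∣)) (trans
      (sym (sum-+-≡ λ i → pointwise (f i) (g i))) ∣f∣))
      where
      pointwise : ∀ x y → χ x ≡ both x y + onlyˡ x y
      pointwise = from-yes (all-Bool? λ x → all-Bool? λ y → χ x ≟ⁿ both x y + onlyˡ x y)
    only-r : sum (λ i → onlyʳ (f i) (g i)) ≡ q
    only-r = +-cancelˡ-≡ c _ _ (trans (cong (_+ _) (sym ∣f∧g∣)) (trans
      (sym (sum-+-≡ λ i → pointwise (f i) (g i))) ∣g∣))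
      where
      pointwise : ∀ x y → χ y ≡ both x y + onlyʳ x y
      pointwise = from-yes (all-Bool? λ x → all-Bool? λ y → χ y ≟ⁿ both x y + onlyʳ x y)
    n≡ : n ≡ c + p + q + sum (λ i → neither (f i) (g i))
    n≡ = begin
      n                                                    ≡⟨ trans (sum-const n 1) (*-identityʳ n) ⟨
      sum {n} (λ _ → 1)                                    ≡⟨ sum-+-≡ (λ i → pointwise (f i) (g i)) ⟩
      sum (λ i → χ (f i) + onlyʳ (f i) (g i)) + sum (λ i → neither (f i) (g i))
        ≡⟨ cong (_+ sum (λ i → neither (f i) (g i))) (trans (∑-distrib-+ (χ ∘ f) _) (cong₂ _+_ ∣f∣ only-r)) ⟩
      c + p + q + sum (λ i → neither (f i) (g i))          ∎
      where
      open ≡-Reasoning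
      pointwise : ∀ x y → 1 ≡ χ x + onlyʳ x y + neither x y
      pointwise = from-yes (all-Bool? λ x → all-Bool? λ y → 1 ≟ⁿ χ x + onlyʳ x y + neither x y)
    S : Sizes f g c p q (n ∸ (c + p + q))
    S = record
      { size-both = ∣f∧g∣ ; size-onlyˡ = only-l ; size-onlyʳ = only-r
      ; size-neither = sym (trans (cong (_∸ (c + p + q)) n≡) (m+n∸m≡n (c + p + q) _)) }

  -- Necessity: inequalities from counting cells by type

  module _ {n} {L : Square n} (latin : IsLatin L) {R₁ C₁ R₂ C₂ : Subset n} {c p q}
    (S₁ : IsSubsquare L R₁ C₁ (c + p)) (S₂ : IsSubsquare L R₂ C₂ (c + q))
    (S₁₂ : IsSubsquare L (R₁ ∩ R₂) (C₁ ∩ C₂) c) (0<c : 0 < c) where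
    private
      module L   = IsLatin latin
      module S₁  = IsSubsquare S₁
      module S₂  = IsSubsquare S₂
      module S₁₂ = IsSubsquare S₁₂
      d = n ∸ (c + p + q)

    -- Look along one row common to both subsquares, which exists since `0 < c`. A symbol of both
    -- occurs there in a column of `C₁` and in one of `C₂`; these coincide by latinness, so the cell
    -- lies in the intersection. Thus the symbol classes have the same sizes as the row and column
    -- classes.
    common-symbols : ∀ s → lookup S₁₂.symbols s ≡ lookup S₁.symbols s ∧ lookup S₂.symbols s
    common-symbols s with nonempty (subst (0 <_) (sym S₁₂.rows-size) 0<c)
    ... | r , r∈ with lookup S₁₂.symbols s in s∈₁₂ | lookup S₁.symbols s in s∈₁ | lookup S₂.symbols s in s∈₂
    ...   | false | false | _     = refl
    ...   | false | true  | false = refl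
    ...   | true  | true  | true  = refl
    ...   | false | true  | true
        with proj₁ (S₁.row-once r s (proj₁ (x∈p∩q⁻ R₁ R₂ r∈)) (lookup⇒[]= s _ s∈₁))
           | proj₁ (S₂.row-once r s (proj₂ (x∈p∩q⁻ R₁ R₂ r∈)) (lookup⇒[]= s _ s∈₂))
    ...     | c₁ , c₁∈ , refl | c₂ , c₂∈ , e₂ with proj₂ (L.row-once r (L r c₁)) c₁ c₂ refl e₂
    ...       | refl = trans (sym s∈₁₂) ([]=⇒lookup (S₁₂.entries-in r c₁ r∈ (x∈p∩q⁺ (c₁∈ , c₂∈))))
    common-symbols s | r , r∈ | true | false | _
        with proj₁ (S₁₂.row-once r s r∈ (lookup⇒[]= s _ s∈₁₂))
    ...     | j , j∈ , refl = trans (sym ([]=⇒lookup (S₁.entries-in r j (proj₁ (x∈p∩q⁻ R₁ R₂ r∈)) (proj₁ (x∈p∩q⁻ C₁ C₂ j∈))))) s∈₁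
    common-symbols s | r , r∈ | true | true | false
        with proj₁ (S₁₂.row-once r s r∈ (lookup⇒[]= s _ s∈₁₂))
    ...     | j , j∈ , refl = trans (sym ([]=⇒lookup (S₂.entries-in r j (proj₂ (x∈p∩q⁻ R₁ R₂ r∈)) (proj₂ (x∈p∩q⁻ C₁ C₂ j∈))))) s∈₂

    subset-sizes : ∀ (X Y : Subset n) → ∣ X ∣ ≡ c + p → ∣ Y ∣ ≡ c + q → sum (λ i → χ (lookup X i ∧ lookup Y i)) ≡ c →
      Sizes (lookup X) (lookup Y) c p q d × n ≡ c + p + q + d
    subset-sizes X Y ∣X∣ ∣Y∣ = sizes (lookup X) (lookup Y) (trans (sym (∣∣≡sum X)) ∣X∣) (trans (sym (∣∣≡sum Y)) ∣Y∣)

    ∩-size : ∀ (X Y : Subset n) → ∣ X ∩ Y ∣ ≡ c → sum (λ i → χ (lookup X i ∧ lookup Y i)) ≡ c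
    ∩-size X Y eq = trans (sum-cong-≗ λ i → cong χ (sym (lookup-zipWith _∧_ i X Y))) (trans (sym (∣∣≡sum (X ∩ Y))) eq)

    private
      rows-sizes = subset-sizes R₁ R₂ S₁.rows-size S₂.rows-size (∩-size R₁ R₂ S₁₂.rows-size)
      cols-sizes = subset-sizes C₁ C₂ S₁.cols-size S₂.cols-size (∩-size C₁ C₂ S₁₂.cols-size)
      syms-sizes = subset-sizes S₁.symbols S₂.symbols S₁.syms-size S₂.syms-size
        (trans (sum-cong-≗ λ s → cong χ (sym (common-symbols s))) (trans (sym (∣∣≡sum S₁₂.symbols)) S₁₂.syms-size))
      module R = Sizes (proj₁ rows-sizes)
      module C = Sizes (proj₁ cols-sizes)
      module S = Sizes (proj₁ syms-sizes)
      row-of : (Bool → Bool → ℕ) → Vector ℕ n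
      row-of e r = e (lookup R₁ r) (lookup R₂ r)
      col-of : (Bool → Bool → ℕ) → Vector ℕ n
      col-of e j = e (lookup C₁ j) (lookup C₂ j)
      sym-of : (Bool → Bool → ℕ) → Vector ℕ n
      sym-of e s = e (lookup S₁.symbols s) (lookup S₂.symbols s)

      -- The type of a cell is given by six membership bits. An inequality between counts follows
      -- from its truth on each pattern allowed by `notTwo`, and these finitely many cases are
      -- settled by evaluation.
      by-cases : (lhs rhs : (r₁ r₂ c₁ c₂ s₁ s₂ : Bool) → ℕ) → Set
      by-cases lhs rhs = ∀ r₁ r₂ c₁ c₂ s₁ s₂ → notTwo r₁ c₁ s₁ ≡ true → notTwo r₂ c₂ s₂ ≡ true →
        lhs r₁ r₂ c₁ c₂ s₁ s₂ ≤ rhs r₁ r₂ c₁ c₂ s₁ s₂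

      by-cases? : ∀ lhs rhs → Dec (by-cases lhs rhs)
      by-cases? lhs rhs = all-Bool? λ r₁ → all-Bool? λ r₂ → all-Bool? λ c₁ → all-Bool? λ c₂ →
        all-Bool? λ s₁ → all-Bool? λ s₂ → (notTwo r₁ c₁ s₁ ≟ᵇ true) →-dec ((notTwo r₂ c₂ s₂ ≟ᵇ true) →-dec
          (lhs r₁ r₂ c₁ c₂ s₁ s₂ ≤? rhs r₁ r₂ c₁ c₂ s₁ s₂))

      at : (f : (r₁ r₂ c₁ c₂ s₁ s₂ : Bool) → ℕ) → Fin n → Fin n → Fin n → ℕ
      at f r j s = f (lookup R₁ r) (lookup R₂ r) (lookup C₁ j) (lookup C₂ j) (lookup S₁.symbols s) (lookup S₂.symbols s)

      cells-≤ : ∀ lhs rhs → by-cases lhs rhs → cells latin (at lhs) ≤ cells latin (at rhs)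
      cells-≤ lhs rhs ineq = cells-mono latin {at lhs} {at rhs} λ r j →
        ineq (lookup R₁ r) (lookup R₂ r) (lookup C₁ j) (lookup C₂ j) (lookup S₁.symbols (L r j)) (lookup S₂.symbols (L r j))
          (subsquare⇒notTwo latin S₁ r j) (subsquare⇒notTwo latin S₂ r j)

    n≡c+p+q+d : n ≡ c + p + q + d
    n≡c+p+q+d = proj₂ rows-sizes

    -- A row of the first subsquare only meets a common column in a symbol of the first subsquare
    -- only. Compare the two counts and cancel `p`.
    c≤p : 0 < p → c ≤ p
    c≤p 0<p = *-cancelˡ-≤ p {{>-nonZero 0<p}} (begin
      p * c                                            ≡⟨ cong₂ _*_ R.size-onlyˡ C.size-both ⟨
      sum (row-of onlyˡ) * sum (col-of both)           ≡⟨ cells-rows-cols latin (row-of onlyˡ) (col-of both) ⟨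
      cells latin (λ r j s → row-of onlyˡ r * col-of both j)    ≤⟨ cells-≤ _ _ (from-yes (by-cases?
        (λ r₁ r₂ c₁ c₂ s₁ s₂ → onlyˡ r₁ r₂ * both c₁ c₂) (λ r₁ r₂ c₁ c₂ s₁ s₂ → onlyˡ r₁ r₂ * onlyˡ s₁ s₂))) ⟩
      cells latin (λ r j s → row-of onlyˡ r * sym-of onlyˡ s)   ≡⟨ cells-rows-syms latin (row-of onlyˡ) (sym-of onlyˡ) ⟩
      sum (row-of onlyˡ) * sum (sym-of onlyˡ)          ≡⟨ cong₂ _*_ R.size-onlyˡ S.size-onlyˡ ⟩
      p * p                                            ∎)
      where open ≤-Reasoning

    -- A row of the first subsquare only meets a column of the second only in a symbol belonging to
    -- neither.
    q≤d : 0 < p → q ≤ d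
    q≤d 0<p = *-cancelˡ-≤ p {{>-nonZero 0<p}} (begin
      p * q                                            ≡⟨ cong₂ _*_ R.size-onlyˡ C.size-onlyʳ ⟨
      sum (row-of onlyˡ) * sum (col-of onlyʳ)          ≡⟨ cells-rows-cols latin (row-of onlyˡ) (col-of onlyʳ) ⟨
      cells latin (λ r j s → row-of onlyˡ r * col-of onlyʳ j)   ≤⟨ cells-≤ _ _ (from-yes (by-cases?
        (λ r₁ r₂ c₁ c₂ s₁ s₂ → onlyˡ r₁ r₂ * onlyʳ c₁ c₂) (λ r₁ r₂ c₁ c₂ s₁ s₂ → onlyˡ r₁ r₂ * neither s₁ s₂))) ⟩
      cells latin (λ r j s → row-of onlyˡ r * sym-of neither s) ≡⟨ cells-rows-syms latin (row-of onlyˡ) (sym-of neither) ⟩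
      sum (row-of onlyˡ) * sum (sym-of neither)        ≡⟨ cong₂ _*_ R.size-onlyˡ S.size-neither ⟩
      p * d                                            ∎)
      where open ≤-Reasoning

    -- Count the symbols of either subsquare in the columns outside both.
    d[c+p+q]≤d²+2pq : d * (c + p + q) ≤ d * d + 2 * (p * q)
    d[c+p+q]≤d²+2pq = begin
      d * (c + p + q)
        ≡⟨ cong₂ _*_ C.size-neither S.size-either ⟨
      sum (col-of neither) * sum (sym-of (λ x y → χ (x ∨ y)))
        ≡⟨ cells-cols-syms latin (col-of neither) (sym-of λ x y → χ (x ∨ y)) ⟨
      cells latin (λ r j s → col-of neither j * sym-of (λ x y → χ (x ∨ y)) s)
        -- With the column outside both, the row avoids each subsquare that contains the symbol. So
        -- the row lies in neither, or else row and symbol belong to opposite subsquares only.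
        ≤⟨ cells-≤ _ _ (from-yes (by-cases?
             (λ r₁ r₂ c₁ c₂ s₁ s₂ → neither c₁ c₂ * χ (s₁ ∨ s₂))
             (λ r₁ r₂ c₁ c₂ s₁ s₂ → neither r₁ r₂ * neither c₁ c₂
               + (onlyʳ r₁ r₂ * onlyˡ s₁ s₂ + onlyˡ r₁ r₂ * onlyʳ s₁ s₂)))) ⟩
      cells latin (λ r j s → nn r j s + (rl r j s + lr r j s))
        ≡⟨ trans (cells-+ latin nn (λ r j s → rl r j s + lr r j s)) (cong (cells latin nn +_) (cells-+ latin rl lr)) ⟩
      cells latin nn + (cells latin rl + cells latin lr)
        ≡⟨ cong₂ _+_ (cells-rows-cols latin (row-of neither) (col-of neither))
             (cong₂ _+_ (cells-rows-syms latin (row-of onlyʳ) (sym-of onlyˡ)) (cells-rows-syms latin (row-of onlyˡ) (sym-of onlyʳ))) ⟩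
      sum (row-of neither) * sum (col-of neither) +
        (sum (row-of onlyʳ) * sum (sym-of onlyˡ) + sum (row-of onlyˡ) * sum (sym-of onlyʳ))
        ≡⟨ cong₂ _+_ (cong₂ _*_ R.size-neither C.size-neither)
             (cong₂ _+_ (cong₂ _*_ R.size-onlyʳ S.size-onlyˡ) (cong₂ _*_ R.size-onlyˡ S.size-onlyʳ)) ⟩
      d * d + (q * p + p * q)
        ≡⟨ cong (d * d +_) (qp+pq q p) ⟩
      d * d + 2 * (p * q) ∎
      where
      open ≤-Reasoning
      nn rl lr : Fin n → Fin n → Fin n → ℕ
      nn r j s = row-of neither r * col-of neither j
      rl r j s = row-of onlyʳ r * sym-of onlyˡ s
      lr r j s = row-of onlyˡ r * sym-of onlyʳ s
      qp+pq : ∀ q p → q * p + p * q ≡ 2 * (p * q)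
      qp+pq = solve-∀

-- From integer to natural conditions, and the equivalence

open import Data.Nat using (ℕ; _<_; _≤_)
open import Data.Integer using (ℤ; +_; _-_; _*_; _+_; _≥_)
open import Data.Product using (_×_)
open import Function.Bundles using (_⇔_)

import Data.Nat as ℕ
import Data.Nat.Properties as ℕ
import Data.Nat.Tactic.RingSolver as ℕ-Solver
open import Data.Integer using (0ℤ; +≤+) renaming (_≤_ to _≤ᶻ_)
open import Data.Integer.Properties using (i≤j⇒0≤j-i; 0≤i-j⇒j≤i; pos-*; drop‿+≤+)
open import Data.Integer.Tactic.RingSolver using (solve-∀)
open import Data.Product using (_,_; proj₁)
open import Function.Bundles using (mk⇔)
open import Relation.Binary.PropositionalEquality using (_≡_; refl; sym; trans; cong; cong₂; subst)
open LatinConfigurations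

-- Reduces each translation of an inequality to one ring identity, usable in both directions.
≤-by-difference : ∀ {i j k l} → l - k ≡ j - i → i ≤ᶻ j → k ≤ᶻ l
≤-by-difference eq i≤j = 0≤i-j⇒j≤i (subst (0ℤ ≤ᶻ_) (sym eq) (i≤j⇒0≤j-i i≤j))

NatConditions : ℕ → ℕ → ℕ → ℕ → Set
NatConditions c p q d = c ≤ p × q ≤ d × d ℕ.* (c ℕ.+ p ℕ.+ q) ≤ d ℕ.* d ℕ.+ 2 ℕ.* (p ℕ.* q)

IntConditions : ℕ → ℕ → ℕ → ℕ → Set
IntConditions n a b c =
  (((+ n - + 2 * + b) ≥ (+ a - + 2 * + c) × (+ a - + 2 * + c) ≥ + 0)
  × ((+ n - + 2 * + a) * (+ n - + 2 * + b)) ≥ (+ c * + c - (+ n - + 2 * + a - + 2 * + b + + 3 * + c) * (+ n - + 2 * + a - + 2 * + b + + 3 * + c)))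

module Translation (c p q d : ℕ) where
  private
    C = + c
    P = + p
    Q = + q
    D = + d

  difference₁ : (C + P + Q + D - + 2 * (C + Q)) - (C + P - + 2 * C) ≡ D - Q
  difference₁ = lem C P Q D
    where
    lem : ∀ C P Q D → (C + P + Q + D - + 2 * (C + Q)) - (C + P - + 2 * C) ≡ D - Q
    lem = solve-∀

  difference₂ : (C + P - + 2 * C) - + 0 ≡ P - C
  difference₂ = lem C P
    where
    lem : ∀ C P → (C + P - + 2 * C) - + 0 ≡ P - C
    lem = solve-∀

  -- Here `n - 2a - 2b + 3c` is `d - p - q`, and `(n - 2a)(n - 2b)` is `(d - c)² - (p - q)²`.
  -- Expanding leaves exactly twice the slack of the natural condition, hence the factor 2.
  difference₃ :
    (C + P + Q + D - + 2 * (C + P)) * (C + P + Q + D - + 2 * (C + Q))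
      - (C * C - (C + P + Q + D - + 2 * (C + P) - + 2 * (C + Q) + + 3 * C)
               * (C + P + Q + D - + 2 * (C + P) - + 2 * (C + Q) + + 3 * C))
    ≡ + (2 ℕ.* (d ℕ.* d ℕ.+ 2 ℕ.* (p ℕ.* q))) - + (2 ℕ.* (d ℕ.* (c ℕ.+ p ℕ.+ q)))
  difference₃ = trans (lem C P Q D) (sym (cong₂ _-_
    (trans (pos-* 2 (d ℕ.* d ℕ.+ 2 ℕ.* (p ℕ.* q))) (cong (+ 2 *_) (cong₂ _+_ (pos-* d d) (trans (pos-* 2 (p ℕ.* q)) (cong (+ 2 *_) (pos-* p q))))))
    (trans (pos-* 2 (d ℕ.* (c ℕ.+ p ℕ.+ q))) (cong (+ 2 *_) (pos-* d (c ℕ.+ p ℕ.+ q))))))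
    where
    lem : ∀ C P Q D →
      (C + P + Q + D - + 2 * (C + P)) * (C + P + Q + D - + 2 * (C + Q))
        - (C * C - (C + P + Q + D - + 2 * (C + P) - + 2 * (C + Q) + + 3 * C)
                 * (C + P + Q + D - + 2 * (C + P) - + 2 * (C + Q) + + 3 * C))
      ≡ + 2 * (D * D + + 2 * (P * Q)) - + 2 * (D * (C + P + Q))
    lem = solve-∀

  toInt : NatConditions c p q d → IntConditions (c ℕ.+ p ℕ.+ q ℕ.+ d) (c ℕ.+ p) (c ℕ.+ q) c
  toInt (c≤p , q≤d , bound) =
    (≤-by-difference difference₁ (+≤+ q≤d) , ≤-by-difference difference₂ (+≤+ c≤p)) ,
    ≤-by-difference difference₃ (+≤+ (ℕ.*-monoʳ-≤ 2 bound))

  fromInt : IntConditions (c ℕ.+ p ℕ.+ q ℕ.+ d) (c ℕ.+ p) (c ℕ.+ q) c → NatConditions c p q d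
  fromInt ((i₁ , i₂) , i₃) =
    drop‿+≤+ (≤-by-difference (sym difference₂) i₂) , drop‿+≤+ (≤-by-difference (sym difference₁) i₁) ,
    ℕ.*-cancelˡ-≤ 2 (drop‿+≤+ (≤-by-difference (sym difference₃) i₃))

open Translation

necessary : ∀ n c p q → 0 < c → 0 < p → HasConfiguration n (c ℕ.+ p) (c ℕ.+ q) c → IntConditions n (c ℕ.+ p) (c ℕ.+ q) c
necessary n c p q 0<c 0<p (L , latin , R₁ , C₁ , R₂ , C₂ , S₁ , S₂ , S₁₂) =
  subst (λ n → IntConditions n (c ℕ.+ p) (c ℕ.+ q) c) (sym (n≡c+p+q+d latin S₁ S₂ S₁₂ 0<c))
    (toInt c p q (n ℕ.∸ (c ℕ.+ p ℕ.+ q))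
      (c≤p latin S₁ S₂ S₁₂ 0<c 0<p , q≤d latin S₁ S₂ S₁₂ 0<c 0<p , d[c+p+q]≤d²+2pq latin S₁ S₂ S₁₂ 0<c))

-- With `p ≤ q`, the bounds `c ≤ p` and `q ≤ d` also give `c ≤ q` and `p ≤ d`. So all the
-- differences `e`, `f`, `g`, `h` and `E` entering the outline square are natural numbers.
sufficient : ∀ c p q d → p ≤ q → NatConditions c p q d →
  HasConfiguration (c ℕ.+ p ℕ.+ q ℕ.+ d) (c ℕ.+ p) (c ℕ.+ q) c
sufficient c p q d p≤q (c≤p , q≤d , bound)
  with ℕ.m≤n⇒∃[o]m+o≡n c≤p | ℕ.m≤n⇒∃[o]m+o≡n (ℕ.≤-trans c≤p p≤q)
... | e , refl | f , refl
  with ℕ.m≤n⇒∃[o]m+o≡n q≤d | ℕ.m≤n⇒∃[o]m+o≡n (ℕ.≤-trans p≤q q≤d) | ℕ.m≤n⇒∃[o]m+o≡n bound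
... | g , q+g≡d | h , p+h≡d | E , E-eq =
  Outline.configuration c e f g h E d (sym q+g≡d) (sym p+h≡d) (trans (ℕ.+-comm E _) E-eq)

-- With `t` equal to `n - b`, the first integer condition says `p + q ≤ t`. This is needed before
-- `n` can be written as `c + p + q + d` with a natural number `d`.
difference₀ : ∀ c p q t → (+ (c ℕ.+ q ℕ.+ t) - + 2 * + (c ℕ.+ q)) - (+ (c ℕ.+ p) - + 2 * + c) ≡ + t - + (p ℕ.+ q)
difference₀ c p q t = lem (+ c) (+ p) (+ q) (+ t)
  where
  lem : ∀ C P Q T → (C + Q + T - + 2 * (C + Q)) - (C + P - + 2 * C) ≡ T - (P + Q)
  lem = solve-∀

theorem1p2 : (n a b c : ℕ) → 0 < c → c < a → a ≤ b → b < n →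
    HasConfiguration n a b c ⇔
    (((+ n - + 2 * + b) ≥ (+ a - + 2 * + c) × (+ a - + 2 * + c) ≥ + 0)
    × ((+ n - + 2 * + a) * (+ n - + 2 * + b)) ≥ (+ c * + c - (+ n - + 2 * + a - + 2 * + b + + 3 * + c) * (+ n - + 2 * + a - + 2 * + b + + 3 * + c)))
theorem1p2 n a b c 0<c c<a a≤b b<n
  with ℕ.m≤n⇒∃[o]m+o≡n (ℕ.<⇒≤ c<a) | ℕ.m≤n⇒∃[o]m+o≡n (ℕ.≤-trans (ℕ.<⇒≤ c<a) a≤b) | ℕ.m≤n⇒∃[o]m+o≡n (ℕ.<⇒≤ b<n)
-- `p`, `q` and `t` are `a - c`, `b - c` and `n - b`.
... | p , refl | q , refl | t , refl = mk⇔ (necessary _ c p q 0<c 0<p) backward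
  where
  0<p : 0 < p
  0<p = ℕ.+-cancelˡ-< c 0 p (subst (_< c ℕ.+ p) (sym (ℕ.+-identityʳ c)) c<a)
  backward : IntConditions (c ℕ.+ q ℕ.+ t) (c ℕ.+ p) (c ℕ.+ q) c → HasConfiguration (c ℕ.+ q ℕ.+ t) (c ℕ.+ p) (c ℕ.+ q) c
  backward ints with ℕ.m≤n⇒∃[o]m+o≡n (ℕ.m+n≤o⇒m≤o p (drop‿+≤+ (≤-by-difference (sym (difference₀ c p q t)) (proj₁ (proj₁ ints)))))
  ... | d , refl = subst (λ n → HasConfiguration n (c ℕ.+ p) (c ℕ.+ q) c) (sym n≡)
      (sufficient c p q d (ℕ.+-cancelˡ-≤ c p q a≤b)
        (fromInt c p q d (subst (λ n → IntConditions n (c ℕ.+ p) (c ℕ.+ q) c) n≡ ints)))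
    where
    n≡ : c ℕ.+ q ℕ.+ (p ℕ.+ d) ≡ c ℕ.+ p ℕ.+ q ℕ.+ d
    n≡ = lem c p q d
      where
      lem : ∀ c p q d → c ℕ.+ q ℕ.+ (p ℕ.+ d) ≡ c ℕ.+ p ℕ.+ q ℕ.+ d
      lem = ℕ-Solver.solve-∀
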